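{- The problem "is a given composite state stable?" is algorithmically decidable for CFSM protocols with the rational channel property whose communication graph has two nodes $0,1$ and two parallel edges $\alpha,\beta$, both from $0$ to $1$.
   Context: A CFSM protocol $\mathbf P$ has a finite directed communication graph $G=(N,E)$ (edge $\xi$ has tail $-\xi$, head $+\xi$), pairwise disjoint finite message sets $M_\xi$, and for each $j\in N$ a finite state machine $F_j=(K_j,\Sigma_j,T_j,h_j)$: finite state set $K_j$, initial state $h_j$, alphabet $\Sigma_j=\{+b: b\in M_\xi,\ j=+\xi\}\cup\{ -b: b\in M_\xi,\ j=-\xi\}$, transitions $T_j\subseteq K_j\times\Sigma_j\times K_j$ ($+b$ = receive, $-b$ = send). A composite state is $S=(p_j:j\in N)$; a channel content is $C=(x_\xi:\xi\in E)$, $x_\xi\in M_\xi^*$; global states are pairs $(S,C)$; $C^0$ has all components empty; $S^0=(h_j:j\in N)$. A step: some machine $F_i$ takes $p_i\xrightarrow{ -b}q_i$ with $b\in M_\beta$, $i=-\beta$, appending $b$ to the end of $x_\beta$; or takes $p_i\xrightarrow{+b}q_i$ with $b\in M_\beta$, $i=+\beta$, provided $x_\beta$ begins with $b$, removing it; all else unchanged. Reachable means reachable from $(S^0,C^0)$ by finitely many steps. A composite state $S$ is stable if $(S,C^0)$ is reachable. $\mathbf P$ has the rational channel property if for each composite state $S$ the set $\mathbf L(S)=\{C:(S,C)\text{ reachable}\}$ is a rational subset of the monoid $\prod_{\xi\in E}M_\xi^*$ (i.e. belongs to the smallest family containing finite sets and closed under union, componentwise product and Kleene star). -}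

module Defs where

open import Level using (0ℓ; suc)
open import Algebra.Bundles using (Monoid)
open import Data.Bool.Base using (Bool)
open import Data.Fin.Base using (Fin; zero) renaming (suc to fsuc)
open import Data.List.Base using (List; []; _∷_; _++_; _∷ʳ_)
open import Data.List.Properties using (++-assoc; ++-identityʳ)
open import Data.List.Membership.Propositional using (_∈_)
import Data.List.Membership.Setoid as SetoidMembership
open import Data.Maybe.Base using (Maybe; just; nothing)
open import Data.Nat.Base using (ℕ; _<_)
open import Data.Product.Base using (∃; ∃₂; _×_; _,_)
open import Relation.Binary.PropositionalEquality using (_≡_; _≢_; refl; sym; trans; cong₂)
open import Relation.Unary using (Pred; _∪_; _≐_)

module _ (M : Monoid 0ℓ 0ℓ) where
  open Monoid M
  open SetoidMembership setoid using () renaming (_∈_ to _∈ₛ_)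

  FiniteSet : List Carrier → Pred Carrier 0ℓ
  FiniteSet xs x = x ∈ₛ xs

  Product : Pred Carrier 0ℓ → Pred Carrier 0ℓ → Pred Carrier 0ℓ
  Product A B x = ∃₂ λ a b → A a × B b × x ≈ a ∙ b

  data KleeneStar (A : Pred Carrier 0ℓ) : Pred Carrier 0ℓ where
    unit : ∀ {x} → x ≈ ε → KleeneStar A x
    mult : ∀ {x a b} → A a → KleeneStar A b → x ≈ a ∙ b → KleeneStar A x

  -- Subsets are predicates, so the family has to be closed explicitly under
  -- extensional equality (resp).
  data Rational : Pred (Pred Carrier 0ℓ) (suc 0ℓ) where
    finite : ∀ xs → Rational (FiniteSet xs)
    union  : ∀ {A B} → Rational A → Rational B → Rational (A ∪ B)
    prod   : ∀ {A B} → Rational A → Rational B → Rational (Product A B)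
    star   : ∀ {A} → Rational A → Rational (KleeneStar A)
    resp   : ∀ {A B} → A ≐ B → Rational A → Rational B

record Graph : Set where
  field
    nodes edges : ℕ
  Node = Fin nodes
  Edge = Fin edges
  field
    tail head : Edge → Node

-- The alphabet of machine j.  The message sets M ξ are made pairwise disjoint
-- by tagging: a letter carries its edge ξ along with an element of M ξ.
data Letter (G : Graph) (M : Graph.Edge G → Set) (j : Graph.Node G) : Set where
  recv : (ξ : Graph.Edge G) → j ≡ Graph.head G ξ → M ξ → Letter G M j
  send : (ξ : Graph.Edge G) → j ≡ Graph.tail G ξ → M ξ → Letter G M j

record Protocol (G : Graph) : Set where
  open Graph G
  field
    messages : Edge → ℕ
    states   : Node → ℕ

  M : Edge → Set
  M ξ = Fin (messages ξ)

  K : Node → Set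
  K j = Fin (states j)

  field
    transitions : (j : Node) → List (K j × Letter G M j × K j)
    initial     : (j : Node) → K j

module _ {G : Graph} (P : Protocol G) where
  open Graph G
  open Protocol P

  CompositeState : Set
  CompositeState = (j : Node) → K j

  ChannelContent : Set
  ChannelContent = (ξ : Edge) → List (M ξ)

  GlobalState : Set
  GlobalState = CompositeState × ChannelContent

  C⁰ : ChannelContent
  C⁰ ξ = []

  S⁰ : CompositeState
  S⁰ = initial

  data Step : GlobalState → GlobalState → Set where
    sendStep : ∀ {S C S′ C′} (i : Node) (β : Edge) (i≡-β : i ≡ tail β) (b : M β) →
               (S i , send β i≡-β b , S′ i) ∈ transitions i →
               (∀ j → j ≢ i → S′ j ≡ S j) →
               C′ β ≡ C β ∷ʳ b →
               (∀ ξ → ξ ≢ β → C′ ξ ≡ C ξ) →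
               Step (S , C) (S′ , C′)
    recvStep : ∀ {S C S′ C′} (i : Node) (β : Edge) (i≡+β : i ≡ head β) (b : M β) →
               (S i , recv β i≡+β b , S′ i) ∈ transitions i →
               (∀ j → j ≢ i → S′ j ≡ S j) →
               C β ≡ b ∷ C′ β →
               (∀ ξ → ξ ≢ β → C′ ξ ≡ C ξ) →
               Step (S , C) (S′ , C′)

  -- Tuples are functions on finite sets and are compared pointwise (there is
  -- no function extensionality); hence start is not stated with ≡ on tuples,
  -- and Star Step (S⁰ , C⁰) is not used.
  data Reachable : GlobalState → Set where
    start : ∀ {S C} → (∀ j → S j ≡ S⁰ j) → (∀ ξ → C ξ ≡ C⁰ ξ) → Reachable (S , C)
    step  : ∀ {s s′} → Reachable s → Step s s′ → Reachable s′

  Stable : CompositeState → Set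
  Stable S = Reachable (S , C⁰)

  channelMonoid : Monoid 0ℓ 0ℓ
  channelMonoid = record
    { Carrier  = ChannelContent
    ; _≈_      = λ C D → ∀ ξ → C ξ ≡ D ξ
    ; _∙_      = λ C D ξ → C ξ ++ D ξ
    ; ε        = C⁰
    ; isMonoid = record
      { isSemigroup = record
        { isMagma = record
          { isEquivalence = record
            { refl  = λ ξ → refl
            ; sym   = λ p ξ → sym (p ξ)
            ; trans = λ p q ξ → trans (p ξ) (q ξ)
            }
          ; ∙-cong = λ p q ξ → cong₂ _++_ (p ξ) (q ξ)
          }
        ; assoc = λ C D E ξ → ++-assoc (C ξ) (D ξ) (E ξ)
        }
      ; identity = (λ C ξ → refl) , (λ C ξ → ++-identityʳ (C ξ))
      }
    }

  𝐋 : CompositeState → Pred ChannelContent 0ℓ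
  𝐋 S C = Reachable (S , C)

  RationalChannelProperty : Set₁
  RationalChannelProperty = ∀ S → Rational channelMonoid (𝐋 S)

-- The edges zero and fsuc zero are α and β.
parallelGraph : Graph
parallelGraph = record
  { nodes = 2
  ; edges = 2
  ; tail  = λ _ → zero
  ; head  = λ _ → fsuc zero
  }

-- A possibly diverging computation: at time n it has either not yet halted
-- (nothing) or shows a result.  Its output is the first result shown.
Computation : Set → Set
Computation A = ℕ → Maybe A

_⇓_ : ∀ {A} → Computation A → A → Set
c ⇓ a = ∃ λ n → c n ≡ just a × (∀ m → m < n → c m ≡ nothing)

-- Algorithms are axiom-free functions into computations.  The rational channel
-- property is deliberately not an argument: testing C⁰ for membership in a given
-- rational 𝐋 S would be trivial.
Algorithm : Graph → Set
Algorithm G = (P : Protocol G) → CompositeState P → Computation Bool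

{-# OPTIONS --safe #-}
module Submission where

-- A run ending with empty channels can be rescheduled so that at every moment
-- one of the two channels is empty: the sender moves only while the receiver
-- waits on an empty channel.  Hence instability of S is witnessed by a family of
-- regular languages, one for each channel and each composite state, that is
-- closed under the steps of such schedules and omits the empty word at S.
-- Closure amounts to inclusions of regular languages, which are decidable.
-- Under the rational channel property such a family exists for every unstable
-- S, because the slice of a rational set of channel contents on which one
-- channel is empty is a regular language.  So an unbounded search, for a run to
-- (S , C⁰) and for such a family at the same time, always terminates.

open import Defs
open import Level using (0ℓ)
open import Data.Bool.Base using (Bool; true; false)
open import Data.Empty using (⊥)
open import Data.Fin.Base using (Fin; zero; suc; toℕ; combine; funToFin; finToFun)
open import Data.Fin.Properties using (_≟_; any?; all?; combine-injective; finToFun-funToFin; pigeonhole; toℕ<n)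
open import Data.List.Base using (List; []; _∷_; _++_; _∷ʳ_; [_]; length; take; drop; map; allFin; cartesianProductWith)
open import Data.List.Membership.Propositional using (_∈_)
open import Data.List.Membership.Propositional.Properties using (∈-map⁺; ∈-allFin; ∈-++⁺ˡ; ∈-++⁺ʳ; ∈-cartesianProductWith⁺)
import Data.List.Membership.DecPropositional as DecMembership
open import Data.List.Properties using (++-monoid; ++-assoc; ++-identityʳ; ++-conicalˡ; ++-conicalʳ; ∷-injective; length-++; length-take; length-drop; take++drop≡id; ≡-dec)
open import Data.List.Relation.Unary.Any using (Any; here; there; satisfied) renaming (any? to anyList?; map to Any-map)
open import Data.List.Relation.Unary.Any.Properties using (cartesianProductWith⁺)
open import Data.Maybe.Base using (Maybe; just; nothing)
open import Data.Nat.Base using (ℕ; zero; suc; _+_; _*_; _^_; _⊔_; _⊓_; _∸_; _≤_; _<_; z≤n; s≤s)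
open import Data.Nat.Induction using (<-rec)
open import Data.Nat.Properties using (≤-refl; ≤-trans; <⇒≤; ≰⇒>; _≤?_; m≤m⊔n; m≤n⊔m; m⊔n≤o⇒m≤o; m⊔n≤o⇒n≤o; n<1+n; m⊓n≤m; +-monoˡ-≤; +-monoˡ-<; m+[n∸m]≡n; ≤-pred; module ≤-Reasoning)
open import Data.Product.Base using (Σ; ∃; ∃₂; _×_; _,_; proj₁; proj₂; map₂)
import Data.Product.Properties as Product
open import Data.Sum.Base using (_⊎_; inj₁; inj₂; [_,_]′)
open import Function.Base using (_∘_)
open import Relation.Binary.Definitions using (DecidableEquality)
open import Relation.Binary.PropositionalEquality
  using (_≡_; _≢_; refl; sym; trans; cong; cong₂; subst; module ≡-Reasoning)
open import Relation.Nullary using (¬_; Dec; yes; no; contradiction; _×-dec_; _⊎-dec_; _→-dec_; ¬?)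
open import Relation.Nullary.Decidable using (map′; decidable-stable)
open import Relation.Nullary.Reflects using (Reflects; ofʸ; ofⁿ)
open import Relation.Unary using (Pred; Decidable; _∪_; _⊆_; _≐_)

-- Exhaustive search over finite alphabets and short words

Searchable : Set → Set₁
Searchable A = ∀ {P : Pred A 0ℓ} → Decidable P → Dec (∃ P)

Σ-searchable : ∀ {m} {B : Fin m → Set} → (∀ i → Searchable (B i)) → Searchable (Σ (Fin m) B)
Σ-searchable search P? =
  map′ (λ (i , b , p) → (i , b) , p) (λ ((i , b) , p) → i , b , p)
       (any? λ i → search i λ b → P? (i , b))

module _ {A : Set} (search : Searchable A) where

  shortWord? : ∀ n {P : Pred (List A) 0ℓ} → Decidable P → Dec (∃ λ w → length w ≤ n × P w)
  shortWord? zero P? =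
    map′ (λ p → [] , z≤n , p) (λ { ([] , _ , p) → p }) (P? [])
  shortWord? (suc n) P? =
    map′ [ (λ p → [] , z≤n , p) , (λ (a , w , w≤n , p) → a ∷ w , s≤s w≤n , p) ]′
         (λ { ([] , _ , p) → inj₁ p ; (a ∷ w , s≤s w≤n , p) → inj₂ (a , w , w≤n , p) })
         (P? [] ⊎-dec search λ a → shortWord? n λ w → P? (a ∷ w))

  allShortWords? : ∀ n {P : Pred (List A) 0ℓ} → Decidable P → Dec (∀ w → length w ≤ n → P w)
  allShortWords? n P? =
    map′ (λ ∄ w w≤n → decidable-stable (P? w) λ ¬p → ∄ (w , w≤n , ¬p))
         (λ ∀P (w , w≤n , ¬p) → ¬p (∀P w w≤n))
         (¬? (shortWord? n λ w → ¬? (P? w)))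

-- Languages of finite index

_·_ : ∀ {A : Set} → Pred (List A) 0ℓ → Pred (List A) 0ℓ → Pred (List A) 0ℓ
_·_ {A} = Product (++-monoid A)

_* : ∀ {A : Set} → Pred (List A) 0ℓ → Pred (List A) 0ℓ
_* {A} = KleeneStar (++-monoid A)

-- The classes need not form a right congruence: only membership of the
-- continuations has to be determined by them, not their class.
record FiniteIndex {A : Set} (L : Pred (List A) 0ℓ) : Set where
  field
    member?   : Decidable L
    index     : ℕ
    class     : List A → Fin index
    saturated : ∀ {u v} w → class u ≡ class v → L (u ++ w) → L (v ++ w)

open FiniteIndex

-- Levi's lemma for the free monoid: two factorizations of one word have comparable cuts.
++-split : ∀ {A : Set} (u : List A) {w} a {b} → u ++ w ≡ a ++ b →
           (∃ λ d → u ≡ a ++ d × b ≡ d ++ w) ⊎ (∃ λ d → a ≡ u ++ d × w ≡ d ++ b)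
++-split u       []      eq = inj₁ (u , refl , sym eq)
++-split []      (x ∷ a) eq = inj₂ (x ∷ a , refl , eq)
++-split (_ ∷ u) (_ ∷ a) eq with ∷-injective eq
... | refl , eq′ with ++-split u a eq′
...   | inj₁ (d , refl , p) = inj₁ (d , refl , p)
...   | inj₂ (d , refl , p) = inj₂ (d , refl , p)

-- Membership in products and stars by derivatives

module _ {A : Set} {K L : Pred (List A) 0ℓ} where

  -- `K ∘ (c ∷_)` is the Brzozowski derivative of `K` by `c`. The derivative rule for products lets
  -- membership be decided by recursion on the word.
  ·-∷ : ∀ {c w} → (K · L) (c ∷ w) → (K [] × L (c ∷ w)) ⊎ ((K ∘ (c ∷_)) · L) w
  ·-∷ ([]    , b , k , l , refl) = inj₁ (k , l)
  ·-∷ (_ ∷ a , b , k , l , refl) = inj₂ (a , b , k , l , refl)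

  ∷-· : ∀ {c w} → (K [] × L (c ∷ w)) ⊎ ((K ∘ (c ∷_)) · L) w → (K · L) (c ∷ w)
  ∷-· (inj₁ (k , l))              = [] , _ , k , l , refl
  ∷-· (inj₂ (a , b , k , l , eq)) = _ ∷ a , b , k , l , cong (_ ∷_) eq

·-dec : ∀ {A : Set} {K L : Pred (List A) 0ℓ} → Decidable K → Decidable L → Decidable (K · L)
·-dec K? L? [] =
  map′ (λ (k , l) → [] , [] , k , l , refl)
       (λ { ([] , [] , k , l , refl) → k , l })
       (K? [] ×-dec L? [])
·-dec K? L? (c ∷ w) =
  map′ ∷-· ·-∷ ((K? [] ×-dec L? (c ∷ w)) ⊎-dec ·-dec (λ u → K? (c ∷ u)) L? w)

module _ {A : Set} {L : Pred (List A) 0ℓ} where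

  *-++ : ∀ {u v} → (L *) u → (L *) v → (L *) (u ++ v)
  *-++         (unit refl)                       v* = v*
  *-++ {v = v} (mult {a = a} {b = b} l b* refl) v* = mult l (*-++ b* v*) (++-assoc a b v)

  *-∷ : ∀ {c w} → (L *) (c ∷ w) → ((L ∘ (c ∷_)) · (L *)) w
  -- Empty factors are skipped until one supplies the first letter.
  *-∷ (mult {a = []}    l b* refl) = *-∷ b*
  *-∷ (mult {a = _ ∷ a} l b* refl) = a , _ , l , b* , refl

  ∷-* : ∀ {c w} → ((L ∘ (c ∷_)) · (L *)) w → (L *) (c ∷ w)
  ∷-* (a , b , l , b* , eq) = mult l b* (cong (_ ∷_) eq)

  module _ (L? : Decidable L) where

    -- After its first letter, a word of `L *` lies in a product of a derivative of `L` with `L *`.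
    -- Treating all left factors `K` at once keeps the recursion structural in the word.
    ·*-dec : ∀ {K : Pred (List A) 0ℓ} → Decidable K → Decidable (K · (L *))
    ·*-dec K? [] =
      map′ (λ k → [] , [] , k , unit refl , refl) (λ { ([] , [] , k , _ , refl) → k }) (K? [])
    ·*-dec K? (c ∷ w) =
      map′ ∷-· ·-∷
        ((K? [] ×-dec map′ ∷-* *-∷ (·*-dec (λ u → L? (c ∷ u)) w)) ⊎-dec ·*-dec (λ u → K? (c ∷ u)) w)

    *-dec : Decidable (L *)
    *-dec []      = yes (unit refl)
    *-dec (c ∷ w) = map′ ∷-* *-∷ (·*-dec (λ u → L? (c ∷ u)) w)

  -- Factors that end before the cut are passed over one by one. Either none remains, or the next
  -- factor `b ++ c` straddles the cut.
  *-split : ∀ {x} u {w} → (L *) x → x ≡ u ++ w →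
            ((L *) u × w ≡ []) ⊎
            (∃₂ λ a b → ∃₂ λ c d → (L *) a × u ≡ a ++ b × w ≡ c ++ d × L (b ++ c) × (L *) d)
  *-split []      {[]}    (unit refl) eq = inj₁ (unit refl , refl)
  *-split []      {_ ∷ _} (unit refl) ()
  *-split (_ ∷ _)         (unit refl) ()
  *-split u (mult {a = p} l q* refl) eq with ++-split u p (sym eq)
  ... | inj₂ (d , refl , refl) = inj₂ ([] , u , d , _ , unit refl , refl , refl , l , q*)
  ... | inj₁ (d , refl , refl) with *-split d q* refl
  ...   | inj₁ (d* , w≡[]) = inj₁ (mult l d* refl , w≡[])
  ...   | inj₂ (a , b , c , e , a* , refl , refl , l′ , e*) =
            inj₂ (p ++ a , b , c , e , mult l a* refl , sym (++-assoc p a b) , refl , l′ , e*)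

  *-join : ∀ {a b c d} → (L *) a → L (b ++ c) → (L *) d → (L *) ((a ++ b) ++ (c ++ d))
  *-join {a} {b} {c} {d} a* l d* =
    subst (L *) (trans (cong (a ++_) (++-assoc b c d)) (sym (++-assoc a b (c ++ d))))
          (*-++ a* (mult l d* refl))

module _ where
  private
    bit : ∀ {P : Set} → Dec P → Fin 2
    bit (yes _) = suc zero
    bit (no _)  = zero

    bit-transfer : ∀ {P Q : Set} (P? : Dec P) (Q? : Dec Q) → bit P? ≡ bit Q? → P → Q
    bit-transfer (yes _) (yes q) _ _ = q
    bit-transfer (yes _) (no _) () _
    bit-transfer (no ¬p) _ _ p = contradiction p ¬p

  -- The characteristic function is read as a number, so that a set of classes can itself serve as a
  -- class.
  subsetCode : ∀ {n} {P : Pred (Fin n) 0ℓ} → Decidable P → Fin (2 ^ n)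
  subsetCode P? = funToFin (bit ∘ P?)

  subsetCode-⊆ : ∀ {n} {P Q : Pred (Fin n) 0ℓ} (P? : Decidable P) (Q? : Decidable Q) →
                 subsetCode P? ≡ subsetCode Q? → P ⊆ Q
  subsetCode-⊆ P? Q? eq {i} = bit-transfer (P? i) (Q? i) (begin
    bit (P? i)                ≡⟨ finToFun-funToFin (bit ∘ P?) i ⟨
    finToFun (subsetCode P?) i ≡⟨ cong (λ k → finToFun k i) eq ⟩
    finToFun (subsetCode Q?) i ≡⟨ finToFun-funToFin (bit ∘ Q?) i ⟩
    bit (Q? i)                ∎)
    where open ≡-Reasoning

-- Closure properties of finite index

module _ {A : Set} where

  empty-finiteIndex : FiniteIndex {A} (λ _ → ⊥)
  empty-finiteIndex = record
    { member? = λ _ → no λ ()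
    ; index = 1
    ; class = λ _ → zero
    ; saturated = λ _ _ ()
    }

  letter-finiteIndex : DecidableEquality A → ∀ c → FiniteIndex (_≡ [ c ])
  letter-finiteIndex _≟ₐ_ c = record
    { member? = λ w → ≡-dec _≟ₐ_ w [ c ]
    ; index = 3
    ; class = cl
    ; saturated = λ {u} {v} → sat u v
    }
    where
    -- The classes are the empty word, `[ c ]`, and the words that no continuation turns into
    -- `[ c ]`.
    cl : List A → Fin 3
    cl [] = zero
    cl w@(_ ∷ _) with ≡-dec _≟ₐ_ w [ c ]
    ... | yes _ = suc zero
    ... | no _  = suc (suc zero)

    sat : ∀ u v w → cl u ≡ cl v → u ++ w ≡ [ c ] → v ++ w ≡ [ c ]
    sat []      []      w eq p = p
    sat []      (y ∷ v) w eq p with ≡-dec _≟ₐ_ (y ∷ v) [ c ]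
    sat []      (y ∷ v) w () p | yes _
    sat []      (y ∷ v) w () p | no _
    sat (x ∷ []) v      [] eq refl with ≡-dec _≟ₐ_ [ c ] [ c ]
    sat (x ∷ []) []      [] () refl | yes _
    sat (x ∷ []) (y ∷ v) [] eq refl | yes _ with ≡-dec _≟ₐ_ (y ∷ v) [ c ]
    ... | yes q = trans (++-identityʳ (y ∷ v)) q
    sat (x ∷ []) (y ∷ v) [] () refl | yes _ | no _
    sat (x ∷ []) v      [] eq refl | no ¬p = contradiction refl ¬p

  module _ {K L : Pred (List A) 0ℓ} (fK : FiniteIndex K) (fL : FiniteIndex L) where
    private
      pairClass : List A → Fin (index fK * index fL)
      pairClass w = combine (class fK w) (class fL w)

      unpair : ∀ u v → pairClass u ≡ pairClass v → class fK u ≡ class fK v × class fL u ≡ class fL v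
      unpair u v = combine-injective (class fK u) (class fL u) (class fK v) (class fL v)

    ∪-finiteIndex : FiniteIndex (K ∪ L)
    ∪-finiteIndex = record
      { member? = λ w → member? fK w ⊎-dec member? fL w
      ; index = index fK * index fL
      ; class = pairClass
      ; saturated = λ {u} {v} w eq → let (eqK , eqL) = unpair u v eq in
          [ inj₁ ∘ saturated fK w eqK , inj₂ ∘ saturated fL w eqL ]′
      }

    ⇒-finiteIndex : FiniteIndex (λ w → K w → L w)
    ⇒-finiteIndex = record
      { member? = λ w → member? fK w →-dec member? fL w
      ; index = index fK * index fL
      ; class = pairClass
      ; saturated = λ {u} {v} w eq K⇒L k → let (eqK , eqL) = unpair u v eq in
          saturated fL w eqL (K⇒L (saturated fK w (sym eqK) k))
      }

    private
      residuals? : ∀ u → Decidable λ i → (K · λ d → class fL d ≡ i) u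
      residuals? u i = ·-dec (member? fK) (λ d → class fL d ≟ i) u

    -- Once u is read, what matters are its K-class and the L-classes of the
    -- suffixes left after removing a prefix in K.
    ·-finiteIndex : FiniteIndex (K · L)
    ·-finiteIndex = record
      { member? = ·-dec (member? fK) (member? fL)
      ; index = index fK * 2 ^ index fL
      ; class = λ u → combine (class fK u) (subsetCode (residuals? u))
      ; saturated = λ {u} {v} w eq → sat u v w (combine-injective _ _ _ _ eq)
      }
      where
      sat : ∀ u v w →
            class fK u ≡ class fK v × subsetCode (residuals? u) ≡ subsetCode (residuals? v) →
            (K · L) (u ++ w) → (K · L) (v ++ w)
      sat u v w (eqK , eqL) (a , b , k , l , eq) with ++-split u a eq
      ... | inj₂ (d , refl , refl) = v ++ d , b , saturated fK d eqK k , l , sym (++-assoc v d b)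
      ... | inj₁ (d , refl , refl)
        with subsetCode-⊆ (residuals? u) (residuals? v) eqL (a , d , k , refl , refl)
      ...   | a′ , d′ , k′ , eq′ , refl =
                a′ , d′ ++ w , k′ , saturated fL w (sym eq′) l , ++-assoc a′ d′ w

  module _ {L : Pred (List A) 0ℓ} (fL : FiniteIndex L) where

    ∷-finiteIndex : ∀ c → FiniteIndex (λ w → L (c ∷ w))
    ∷-finiteIndex c = record
      { member? = λ w → member? fL (c ∷ w)
      ; index = index fL
      ; class = λ w → class fL (c ∷ w)
      ; saturated = saturated fL
      }

    ∷ʳ-finiteIndex : ∀ c → FiniteIndex (λ w → L (w ∷ʳ c))
    ∷ʳ-finiteIndex c = record
      { member? = λ w → member? fL (w ∷ʳ c)
      ; index = index fL
      ; class = class fL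
      ; saturated = λ {u} {v} w eq l →
          subst L (sym (++-assoc v w [ c ])) (saturated fL (w ∷ʳ c) eq (subst L (++-assoc u w [ c ]) l))
      }

    private
      member*? : ∀ u → Decidable {A = Fin 1} λ _ → (L *) u
      member*? u _ = *-dec (member? fL) u

      residuals*? : ∀ u → Decidable λ i → ((L *) · λ d → class fL d ≡ i) u
      residuals*? u i = ·-dec (*-dec (member? fL)) (λ d → class fL d ≟ i) u

    -- As for the product, with `L *` as the left factor: a straddling factor is controlled by the
    -- `L`-classes of the suffixes left after a prefix in `L *`. The separate bit for membership of
    -- the word itself settles the case in which `w` is empty.
    *-finiteIndex : FiniteIndex (L *)
    *-finiteIndex = record
      { member? = *-dec (member? fL)
      ; index = 2 ^ 1 * 2 ^ index fL
      ; class = λ u → combine (subsetCode (member*? u)) (subsetCode (residuals*? u))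
      ; saturated = λ {u} {v} w eq → sat u v w (combine-injective _ _ _ _ eq)
      }
      where
      sat : ∀ u v w →
            subsetCode (member*? u) ≡ subsetCode (member*? v) ×
            subsetCode (residuals*? u) ≡ subsetCode (residuals*? v) →
            (L *) (u ++ w) → (L *) (v ++ w)
      sat u v w (eq* , eqR) uw* with *-split u uw* refl
      ... | inj₁ (u* , refl) = *-++ (subsetCode-⊆ (member*? u) (member*? v) eq* {zero} u*) (unit refl)
      ... | inj₂ (a , b , c , d , a* , refl , refl , l , d*)
        with subsetCode-⊆ (residuals*? u) (residuals*? v) eqR (a , b , a* , refl , refl)
      ...   | a′ , b′ , a′* , eq′ , refl = *-join {a = a′} {b = b′} a′* (saturated fL c (sym eq′) l) d*

    -- In a word longer than the index two prefixes share their class, and the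
    -- segment between them can be cut out.
    shortWordsSuffice : (∀ w → length w ≤ index fL → L w) → ∀ w → L w
    shortWordsSuffice short w = <-rec (λ n → ∀ w → length w ≡ n → L w) cut (length w) w refl
      where
      cut : ∀ n → (∀ {m} → m < n → ∀ w → length w ≡ m → L w) → ∀ w → length w ≡ n → L w
      cut n rec w refl with length w ≤? index fL
      ... | yes w≤ = short w w≤
      -- The prefixes of lengths 0 to `index fL` are one more than the classes.
      ... | no w≰ with pigeonhole (n<1+n (index fL)) (λ i → class fL (take (toℕ i) w))
      ...   | i , j , i<j , eq =
        subst L (take++drop≡id (toℕ j) w) (saturated fL (drop (toℕ j) w) eq (rec shorter _ refl))
        where
        open ≤-Reasoning
        j≤w : toℕ j ≤ length w
        j≤w = ≤-trans (≤-pred (toℕ<n j)) (<⇒≤ (≰⇒> w≰))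
        shorter : length (take (toℕ i) w ++ drop (toℕ j) w) < length w
        shorter = begin-strict
          length (take (toℕ i) w ++ drop (toℕ j) w)
            ≡⟨ length-++ (take (toℕ i) w) ⟩
          length (take (toℕ i) w) + length (drop (toℕ j) w)
            ≡⟨ cong₂ _+_ (length-take (toℕ i) w) (length-drop (toℕ j) w) ⟩
          (toℕ i ⊓ length w) + (length w ∸ toℕ j)
            ≤⟨ +-monoˡ-≤ _ (m⊓n≤m (toℕ i) (length w)) ⟩
          toℕ i + (length w ∸ toℕ j)
            <⟨ +-monoˡ-< _ i<j ⟩
          toℕ j + (length w ∸ toℕ j)
            ≡⟨ m+[n∸m]≡n j≤w ⟩
          length w ∎

    universal? : Searchable A → Dec (∀ w → L w)
    universal? search =
      map′ shortWordsSuffice (λ ∀L w _ → ∀L w) (allShortWords? search (index fL) (member? fL))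

-- Regular expressions

data Regex (k : ℕ) : Set where
  none      : Regex k
  letter    : Fin k → Regex k
  _⊕_ _⊙_   : Regex k → Regex k → Regex k
  _⋆        : Regex k → Regex k

module _ {k : ℕ} where

  ⟦_⟧ : Regex k → Pred (List (Fin k)) 0ℓ
  ⟦ none ⟧     = λ _ → ⊥
  ⟦ letter c ⟧ = _≡ [ c ]
  ⟦ r ⊕ s ⟧    = ⟦ r ⟧ ∪ ⟦ s ⟧
  ⟦ r ⊙ s ⟧    = ⟦ r ⟧ · ⟦ s ⟧
  ⟦ r ⋆ ⟧      = ⟦ r ⟧ *

  regex-finiteIndex : ∀ r → FiniteIndex ⟦ r ⟧
  regex-finiteIndex none       = empty-finiteIndex
  regex-finiteIndex (letter c) = letter-finiteIndex _≟_ c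
  regex-finiteIndex (r ⊕ s)    = ∪-finiteIndex (regex-finiteIndex r) (regex-finiteIndex s)
  regex-finiteIndex (r ⊙ s)    = ·-finiteIndex (regex-finiteIndex r) (regex-finiteIndex s)
  regex-finiteIndex (r ⋆)      = *-finiteIndex (regex-finiteIndex r)

  -- The empty word has no constructor of its own; `none ⋆` denotes it.
  word : List (Fin k) → Regex k
  word []      = none ⋆
  word (c ∷ w) = letter c ⊙ word w

  word-sound : ∀ u {w} → ⟦ word u ⟧ w → w ≡ u
  word-sound []      (unit eq)                  = eq
  word-sound (c ∷ u) (_ , _ , refl , b∈u , eq) = trans eq (cong (c ∷_) (word-sound u b∈u))

  word-complete : ∀ u → ⟦ word u ⟧ u
  word-complete []      = unit refl
  word-complete (c ∷ u) = [ c ] , u , refl , word-complete u , refl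

  -- The stage at which an expression enters `regexes`. Leaves have depth 1 because stage 0 is
  -- empty.
  depth : Regex k → ℕ
  depth none       = 1
  depth (letter _) = 1
  depth (r ⊕ s)    = suc (depth r ⊔ depth s)
  depth (r ⊙ s)    = suc (depth r ⊔ depth s)
  depth (r ⋆)      = suc (depth r)

  regexes : ℕ → List (Regex k)
  regexes zero    = []
  regexes (suc n) =
    none ∷ map letter (allFin k) ++ map _⋆ (regexes n) ++
    cartesianProductWith _⊕_ (regexes n) (regexes n) ++
    cartesianProductWith _⊙_ (regexes n) (regexes n)

  ∈-regexes : ∀ r {n} → depth r ≤ n → r ∈ regexes n
  ∈-regexes none       (s≤s _) = here refl
  ∈-regexes (letter c) (s≤s _) = there (∈-++⁺ˡ (∈-map⁺ letter (∈-allFin c)))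
  ∈-regexes (r ⋆)      (s≤s p) =
    there (∈-++⁺ʳ (map letter (allFin k)) (∈-++⁺ˡ (∈-map⁺ _⋆ (∈-regexes r p))))
  ∈-regexes (r ⊕ s) {suc n} (s≤s p) =
    there (∈-++⁺ʳ (map letter (allFin k)) (∈-++⁺ʳ (map _⋆ (regexes n)) (∈-++⁺ˡ
      (∈-cartesianProductWith⁺ _⊕_ (∈-regexes r (m⊔n≤o⇒m≤o (depth r) _ p))
                                   (∈-regexes s (m⊔n≤o⇒n≤o (depth r) _ p))))))
  ∈-regexes (r ⊙ s) {suc n} (s≤s p) =
    there (∈-++⁺ʳ (map letter (allFin k)) (∈-++⁺ʳ (map _⋆ (regexes n))
      (∈-++⁺ʳ (cartesianProductWith _⊕_ (regexes n) (regexes n))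
        (∈-cartesianProductWith⁺ _⊙_ (∈-regexes r (m⊔n≤o⇒m≤o (depth r) _ p))
                                     (∈-regexes s (m⊔n≤o⇒n≤o (depth r) _ p))))))

-- Enumeration of finite families

tabulations : ∀ {n} {B : Fin n → Set} → (∀ i → List (B i)) → List (∀ i → B i)
tabulations {zero}      xs = (λ ()) ∷ []
tabulations {suc n} {B} xs = cartesianProductWith cons (xs zero) (tabulations (xs ∘ suc))
  where
  cons : B zero → (∀ i → B (suc i)) → ∀ i → B i
  cons b f zero    = b
  cons b f (suc i) = f i

-- Stated with `Any` instead of membership: without function extensionality a given function occurs
-- in the list only up to pointwise equality.
tabulations⁺ : ∀ {n} {B : Fin n → Set} {xs : ∀ i → List (B i)} {R : ∀ i → Pred (B i) 0ℓ} →
               (∀ i → Any (R i) (xs i)) → Any (λ f → ∀ i → R i (f i)) (tabulations xs)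
tabulations⁺ {zero}  any = here λ ()
tabulations⁺ {suc n} any =
  cartesianProductWith⁺ _ (λ r rs → λ { zero → r ; (suc i) → rs i }) (any zero) (tabulations⁺ (any ∘ suc))

-- Eventual properties and halting computations

Eventually : Pred ℕ 0ℓ → Set
Eventually P = ∃ λ n → ∀ m → n ≤ m → P m

eventually-map : ∀ {P Q : Pred ℕ 0ℓ} → P ⊆ Q → Eventually P → Eventually Q
eventually-map P⊆Q (n , p) = n , λ m n≤m → P⊆Q (p m n≤m)

-- The maximum of finitely many thresholds works for all of them; this is why `Eventually` asks for
-- every large `m` and not for a single one.
eventually-all : ∀ {k} {P : Fin k → Pred ℕ 0ℓ} →
                 (∀ i → Eventually (P i)) → Eventually (λ n → ∀ i → P i n)
eventually-all {zero}  ev = 0 , λ _ _ ()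
eventually-all {suc k} ev with ev zero | eventually-all (ev ∘ suc)
... | n₀ , p₀ | n , p = n₀ ⊔ n , λ m ≤m → λ
  { zero    → p₀ m (m⊔n≤o⇒m≤o n₀ n ≤m)
  ; (suc i) → p m (m⊔n≤o⇒n≤o n₀ n ≤m) i }

-- An earlier time may already show a result, possibly another one, so the output is not claimed to
-- be `a`.
halts : ∀ {A : Set} (c : Computation A) n {a} → c n ≡ just a → ∃ (c ⇓_)
halts c zero    {a} eq = a , zero , eq , λ _ ()
halts c (suc n)     eq with c zero in eq₀
... | just b  = b , zero , eq₀ , λ _ ()
... | nothing with halts (c ∘ suc) n eq
...   | b , m , eqₘ , before =
  b , suc m , eqₘ , λ { zero _ → eq₀ ; (suc i) (s≤s i<m) → before i i<m }

verdict : ∀ {X Y : Set} → Dec X → Dec Y → Maybe Bool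
verdict (yes _) _       = just true
verdict (no _)  (yes _) = just false
verdict (no _)  (no _)  = nothing

verdict-sound : ∀ {X Y Z : Set} (X? : Dec X) (Y? : Dec Y) → (X → Z) → (Y → ¬ Z) →
                ∀ {b} → verdict X? Y? ≡ just b → Reflects Z b
verdict-sound (yes x) _       X⇒Z Y⇒¬Z refl = ofʸ (X⇒Z x)
verdict-sound (no _)  (yes y) X⇒Z Y⇒¬Z refl = ofⁿ (Y⇒¬Z y)

verdict-halts : ∀ {X Y : Set} (X? : Dec X) (Y? : Dec Y) → X ⊎ Y → ∃ λ b → verdict X? Y? ≡ just b
verdict-halts (yes _) _       _        = _ , refl
verdict-halts (no _)  (yes _) _        = _ , refl
verdict-halts (no ¬x) _       (inj₁ x) = contradiction x ¬x
verdict-halts (no _)  (no ¬y) (inj₂ y) = contradiction y ¬y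

-- Slices of the channel monoid

module _ {G : Graph} (P : Protocol G) where
  open Graph G
  open Protocol P

  Slice : (γ : Edge) → Pred (ChannelContent P) 0ℓ → Pred (List (M γ)) 0ℓ
  Slice γ X w = ∃ λ C → X C × C γ ≡ w × (∀ ξ → ξ ≢ γ → C ξ ≡ [])

  -- A product with empty components off γ has factors with empty components
  -- off γ, so slicing commutes with the rational operations.
  slice-regular : ∀ γ {X} → Rational (channelMonoid P) X → ∃ λ r → ⟦ r ⟧ ≐ Slice γ X
  slice-regular γ (finite []) = none , (λ ()) , λ ()
  slice-regular γ (finite (C ∷ Cs))
    with slice-regular γ (finite Cs)
       | all? (λ ξ → ¬? (ξ ≟ γ) →-dec ≡-dec _≟_ (C ξ) [])
  ... | r , r⊆ , ⊆r | yes C≡[] =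
    word (C γ) ⊕ r ,
    (λ { (inj₁ w) → C , here (λ _ → refl) , sym (word-sound (C γ) w) , C≡[]
       ; (inj₂ w) → let (D , D∈ , eq , D≡[]) = r⊆ w in D , there D∈ , eq , D≡[] }) ,
    λ { (D , here D≈C , refl , D≡[]) → inj₁ (subst ⟦ word (C γ) ⟧ (sym (D≈C γ)) (word-complete (C γ)))
      ; (D , there D∈ , eq , D≡[]) → inj₂ (⊆r (D , D∈ , eq , D≡[])) }
  ... | r , r⊆ , ⊆r | no C≢[] =
    r ,
    (λ w → let (D , D∈ , eq , D≡[]) = r⊆ w in D , there D∈ , eq , D≡[]) ,
    λ { (D , here D≈C , eq , D≡[]) → contradiction (λ ξ ξ≢γ → trans (sym (D≈C ξ)) (D≡[] ξ ξ≢γ)) C≢[]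
      ; (D , there D∈ , eq , D≡[]) → ⊆r (D , D∈ , eq , D≡[]) }
  slice-regular γ (union X Y) with slice-regular γ X | slice-regular γ Y
  ... | r , r⊆ , ⊆r | s , s⊆ , ⊆s =
    r ⊕ s ,
    (λ { (inj₁ w) → let (C , x , p) = r⊆ w in C , inj₁ x , p
       ; (inj₂ w) → let (C , y , p) = s⊆ w in C , inj₂ y , p }) ,
    λ { (C , inj₁ x , p) → inj₁ (⊆r (C , x , p)) ; (C , inj₂ y , p) → inj₂ (⊆s (C , y , p)) }
  slice-regular γ (prod X Y) with slice-regular γ X | slice-regular γ Y
  ... | r , r⊆ , ⊆r | s , s⊆ , ⊆s =
    r ⊙ s ,
    (λ { (_ , _ , u , v , refl) →
         let (C , x , eqC , C≡[]) = r⊆ u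
             (D , y , eqD , D≡[]) = s⊆ v
         in (λ ξ → C ξ ++ D ξ) , (C , D , x , y , λ _ → refl) , cong₂ _++_ eqC eqD ,
            λ ξ ξ≢γ → cong₂ _++_ (C≡[] ξ ξ≢γ) (D≡[] ξ ξ≢γ) }) ,
    λ { (E , (C , D , x , y , E≈) , refl , E≡[]) →
        C γ , D γ ,
        ⊆r (C , x , refl , λ ξ ξ≢γ → ++-conicalˡ (C ξ) (D ξ) (trans (sym (E≈ ξ)) (E≡[] ξ ξ≢γ))) ,
        ⊆s (D , y , refl , λ ξ ξ≢γ → ++-conicalʳ (C ξ) (D ξ) (trans (sym (E≈ ξ)) (E≡[] ξ ξ≢γ))) ,
        E≈ γ }
  slice-regular γ (star {X} rX) with slice-regular γ rX
  ... | r , r⊆ , ⊆r = r ⋆ , to , λ (C , x , eq , C≡[]) → from x eq C≡[]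
    where
    to : ⟦ r ⋆ ⟧ ⊆ Slice γ (KleeneStar (channelMonoid P) X)
    to (unit eq)       = C⁰ P , unit (λ _ → refl) , sym eq , λ _ _ → refl
    to (mult u v refl) =
      let (C , x , eqC , C≡[]) = r⊆ u
          (D , y , eqD , D≡[]) = to v
      in (λ ξ → C ξ ++ D ξ) , mult x y (λ _ → refl) , cong₂ _++_ eqC eqD ,
         λ ξ ξ≢γ → cong₂ _++_ (C≡[] ξ ξ≢γ) (D≡[] ξ ξ≢γ)

    from : ∀ {C w} → KleeneStar (channelMonoid P) X C → C γ ≡ w → (∀ ξ → ξ ≢ γ → C ξ ≡ []) → ⟦ r ⋆ ⟧ w
    from (unit C≈[]) refl _ = unit (C≈[] γ)
    from (mult {a = C} {b = D} x y E≈) refl E≡[] =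
      mult (⊆r (C , x , refl , λ ξ ξ≢γ → ++-conicalˡ (C ξ) (D ξ) (trans (sym (E≈ ξ)) (E≡[] ξ ξ≢γ))))
           (from y refl λ ξ ξ≢γ → ++-conicalʳ (C ξ) (D ξ) (trans (sym (E≈ ξ)) (E≡[] ξ ξ≢γ)))
           (E≈ γ)
  slice-regular γ (resp (X⊆Y , Y⊆X) rX) with slice-regular γ rX
  ... | r , r⊆ , ⊆r =
    r ,
    (λ w → let (C , x , p) = r⊆ w in C , X⊆Y x , p) ,
    λ (C , y , p) → ⊆r (C , Y⊆X y , p)

  -- Replaces function extensionality. Only the last step has to be rewritten, since `Step`
  -- constrains its target pointwise.
  reachable-resp : ∀ {S S′ C C′} → (∀ j → S j ≡ S′ j) → (∀ ξ → C ξ ≡ C′ ξ) →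
                   Reachable P (S , C) → Reachable P (S′ , C′)
  reachable-resp S≗ C≗ (start S≡ C≡) =
    start (λ j → trans (sym (S≗ j)) (S≡ j)) (λ ξ → trans (sym (C≗ ξ)) (C≡ ξ))
  reachable-resp S≗ C≗ (step r (sendStep i β i≡ b t S≡ Cβ C≡)) =
    step r (sendStep i β i≡ b (subst (λ s → (_ , _ , s) ∈ _) (S≗ i) t)
      (λ j j≢i → trans (sym (S≗ j)) (S≡ j j≢i))
      (trans (sym (C≗ β)) Cβ)
      (λ ξ ξ≢β → trans (sym (C≗ ξ)) (C≡ ξ ξ≢β)))
  reachable-resp S≗ C≗ (step r (recvStep i β i≡ b t S≡ Cβ C≡)) =
    step r (recvStep i β i≡ b (subst (λ s → (_ , _ , s) ∈ _) (S≗ i) t)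
      (λ j j≢i → trans (sym (S≗ j)) (S≡ j j≢i))
      (trans Cβ (cong (b ∷_) (C≗ β)))
      (λ ξ ξ≢β → trans (sym (C≗ ξ)) (C≡ ξ ξ≢β)))

letter-≟ : ∀ {G M} → (∀ ξ → DecidableEquality (M ξ)) → ∀ {j} → DecidableEquality (Letter G M j)
letter-≟ _≟ₘ_ (recv ξ refl a) (recv ζ eq b) with ξ ≟ ζ
... | no ξ≢ζ = no λ { refl → ξ≢ζ refl }
letter-≟ _≟ₘ_ (recv ξ refl a) (recv ξ refl b) | yes refl =
  map′ (λ { refl → refl }) (λ { refl → refl }) ((ξ ≟ₘ a) b)
letter-≟ _≟ₘ_ (send ξ refl a) (send ζ eq b) with ξ ≟ ζ
... | no ξ≢ζ = no λ { refl → ξ≢ζ refl }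
letter-≟ _≟ₘ_ (send ξ refl a) (send ξ refl b) | yes refl =
  map′ (λ { refl → refl }) (λ { refl → refl }) ((ξ ≟ₘ a) b)
letter-≟ _≟ₘ_ (recv _ _ _) (send _ _ _) = no λ ()
letter-≟ _≟ₘ_ (send _ _ _) (recv _ _ _) = no λ ()

-- Two parallel channels

module Parallel (P : Protocol parallelGraph) where
  open Protocol P

  Sender Receiver Edge Message : Set
  Sender   = K zero
  Receiver = K (suc zero)
  Edge     = Fin 2
  Message  = Σ Edge M

  Sends : Sender → Message → Sender → Set
  Sends p (γ , a) p′ = (p , send γ refl a , p′) ∈ transitions zero

  Receives : Receiver → Message → Receiver → Set
  Receives q (γ , a) q′ = (q , recv γ refl a , q′) ∈ transitions (suc zero)

  transition? : ∀ {j} t → Dec (t ∈ transitions j)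
  transition? t = t ∈? _
    where open DecMembership (Product.≡-dec _≟_ (Product.≡-dec (letter-≟ λ _ → _≟_) _≟_))

  message-searchable : Searchable Message
  message-searchable = Σ-searchable λ _ → any?

  ⟨_,_⟩ : Sender → Receiver → CompositeState P
  ⟨ p , q ⟩ zero       = p
  ⟨ p , q ⟩ (suc zero) = q

  other : Edge → Edge
  other zero       = suc zero
  other (suc zero) = zero

  γ≢other : ∀ γ → γ ≢ other γ
  γ≢other zero       ()
  γ≢other (suc zero) ()

  twoEdges : ∀ {γ δ ξ : Edge} → δ ≢ γ → ξ ≢ γ → ξ ≡ δ
  twoEdges {zero}     {zero}     {_}        δ≢γ ξ≢γ = contradiction refl δ≢γ
  twoEdges {zero}     {suc zero} {zero}     δ≢γ ξ≢γ = contradiction refl ξ≢γ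
  twoEdges {zero}     {suc zero} {suc zero} δ≢γ ξ≢γ = refl
  twoEdges {suc zero} {suc zero} {_}        δ≢γ ξ≢γ = contradiction refl δ≢γ
  twoEdges {suc zero} {zero}     {suc zero} δ≢γ ξ≢γ = contradiction refl ξ≢γ
  twoEdges {suc zero} {zero}     {zero}     δ≢γ ξ≢γ = refl

  -- Message sequences, traces and reachability

  content : List Message → ChannelContent P
  content []             ξ = []
  content ((γ , a) ∷ ts) ξ with ξ ≟ γ
  ... | yes refl = a ∷ content ts ξ
  ... | no _     = content ts ξ

  content-same : ∀ γ {a} ts → content ((γ , a) ∷ ts) γ ≡ a ∷ content ts γ
  content-same γ ts with γ ≟ γ
  ... | yes refl = refl
  ... | no γ≢γ   = contradiction refl γ≢γ

  content-other : ∀ {γ a} ts {ξ} → ξ ≢ γ → content ((γ , a) ∷ ts) ξ ≡ content ts ξ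
  content-other {γ} ts {ξ} ξ≢γ with ξ ≟ γ
  ... | yes ξ≡γ = contradiction ξ≡γ ξ≢γ
  ... | no _    = refl

  content-++ : ∀ ts us ξ → content (ts ++ us) ξ ≡ content ts ξ ++ content us ξ
  content-++ []             us ξ = refl
  content-++ ((γ , a) ∷ ts) us ξ with ξ ≟ γ
  ... | yes refl = cong (a ∷_) (content-++ ts us ξ)
  ... | no _     = content-++ ts us ξ

  content-empty : ∀ ts → (∀ ξ → content ts ξ ≡ []) → ts ≡ []
  content-empty []             _  = refl
  content-empty ((γ , a) ∷ ts) ≡[] with trans (sym (content-same γ ts)) (≡[] γ)
  ... | ()

  empty-content : ∀ γ {C : ChannelContent P} → C γ ≡ [] → (∀ ξ → ξ ≢ γ → C ξ ≡ []) → ∀ ξ → C ξ ≡ []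
  empty-content γ Cγ C≡ ξ with ξ ≟ γ
  ... | yes refl = Cγ
  ... | no ξ≢γ   = C≡ ξ ξ≢γ

  Path : ∀ {n} → (Fin n → Message → Fin n → Set) → Fin n → List Message → Fin n → Set
  Path T p []       p′ = p ≡ p′
  Path T p (t ∷ ts) p″ = ∃ λ p′ → T p t p′ × Path T p′ ts p″

  path-∷ʳ : ∀ {n} {T : Fin n → Message → Fin n → Set} {p p′ p″ t} ts →
            Path T p ts p′ → T p′ t p″ → Path T p (ts ∷ʳ t) p″
  path-∷ʳ []       refl         T[p′,p″] = _ , T[p′,p″] , refl
  path-∷ʳ (_ ∷ ts) (_ , e , es) T[p′,p″] = _ , e , path-∷ʳ ts es T[p′,p″]

  path? : ∀ {n} {T : Fin n → Message → Fin n → Set} → (∀ p t p′ → Dec (T p t p′)) →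
          ∀ p ts p′ → Dec (Path T p ts p′)
  path? T? p []       p″ = p ≟ p″
  path? T? p (t ∷ ts) p″ = any? λ p′ → T? p t p′ ×-dec path? T? p′ ts p″

  Traces : Sender → Receiver → List Message → List Message → Set
  Traces p q ts us = Path Sends (initial zero) ts p × Path Receives (initial (suc zero)) us q

  -- Both edges have the same tail and the same head, so one machine only sends and the other only
  -- receives. A run therefore splits into two independent traces, tied together by the queue
  -- invariant: sent is received followed by pending.
  reachable⇒traces : ∀ {S C} → Reachable P (S , C) →
    ∃₂ λ ts us → Traces (S zero) (S (suc zero)) ts us × (∀ ξ → content ts ξ ≡ content us ξ ++ C ξ)
  reachable⇒traces (start S≡ C≡) =
    [] , [] , (sym (S≡ zero) , sym (S≡ (suc zero))) , λ ξ → sym (C≡ ξ)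
  reachable⇒traces (step {S , C} {S′ , C′} r (sendStep _ β refl b t S≡ Cβ C≡))
    with reachable⇒traces r
  ... | ts , us , (send* , recv*) , eq =
    ts ∷ʳ (β , b) , us ,
    (path-∷ʳ ts send* t , subst (Path Receives _ us) (sym (S≡ (suc zero) λ ())) recv*) , eq′
    where
    open ≡-Reasoning
    appended : ∀ ξ → C ξ ++ content [ β , b ] ξ ≡ C′ ξ
    appended ξ with ξ ≟ β
    ... | yes refl = sym Cβ
    ... | no ξ≢β   = trans (++-identityʳ (C ξ)) (sym (C≡ ξ ξ≢β))
    eq′ : ∀ ξ → content (ts ∷ʳ (β , b)) ξ ≡ content us ξ ++ C′ ξ
    eq′ ξ = begin
      content (ts ∷ʳ (β , b)) ξ                     ≡⟨ content-++ ts _ ξ ⟩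
      content ts ξ ++ content [ β , b ] ξ           ≡⟨ cong (_++ content [ β , b ] ξ) (eq ξ) ⟩
      (content us ξ ++ C ξ) ++ content [ β , b ] ξ  ≡⟨ ++-assoc (content us ξ) (C ξ) _ ⟩
      content us ξ ++ (C ξ ++ content [ β , b ] ξ)  ≡⟨ cong (content us ξ ++_) (appended ξ) ⟩
      content us ξ ++ C′ ξ                          ∎
  reachable⇒traces (step {S , C} {S′ , C′} r (recvStep _ β refl b t S≡ Cβ C≡))
    with reachable⇒traces r
  ... | ts , us , (send* , recv*) , eq =
    ts , us ∷ʳ (β , b) ,
    (subst (Path Sends _ ts) (sym (S≡ zero λ ())) send* , path-∷ʳ us recv* t) , eq′
    where
    open ≡-Reasoning
    removed : ∀ ξ → C ξ ≡ content [ β , b ] ξ ++ C′ ξ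
    removed ξ with ξ ≟ β
    ... | yes refl = Cβ
    ... | no ξ≢β   = sym (C≡ ξ ξ≢β)
    eq′ : ∀ ξ → content ts ξ ≡ content (us ∷ʳ (β , b)) ξ ++ C′ ξ
    eq′ ξ = begin
      content ts ξ                                   ≡⟨ eq ξ ⟩
      content us ξ ++ C ξ                            ≡⟨ cong (content us ξ ++_) (removed ξ) ⟩
      content us ξ ++ (content [ β , b ] ξ ++ C′ ξ)  ≡⟨ ++-assoc (content us ξ) _ _ ⟨
      (content us ξ ++ content [ β , b ] ξ) ++ C′ ξ  ≡⟨ cong (_++ C′ ξ) (content-++ us _ ξ) ⟨
      content (us ∷ʳ (β , b)) ξ ++ C′ ξ              ∎

  sendMessage : ∀ {p q p′ C γ a} → Sends p (γ , a) p′ → Reachable P (⟨ p , q ⟩ , C) →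
                Reachable P (⟨ p′ , q ⟩ , λ ξ → C ξ ++ content [ γ , a ] ξ)
  sendMessage {C = C} {γ = γ} {a = a} t r =
    step r (sendStep zero γ refl a t
      (λ { zero 0≢0 → contradiction refl 0≢0 ; (suc zero) _ → refl })
      (cong (C γ ++_) (content-same γ []))
      (λ ξ ξ≢γ → trans (cong (C ξ ++_) (content-other [] ξ≢γ)) (++-identityʳ (C ξ))))

  receiveMessage : ∀ {p q q′ C C′ γ a} → Receives q (γ , a) q′ →
                   C γ ≡ a ∷ C′ γ → (∀ ξ → ξ ≢ γ → C′ ξ ≡ C ξ) →
                   Reachable P (⟨ p , q ⟩ , C) → Reachable P (⟨ p , q′ ⟩ , C′)
  receiveMessage {γ = γ} {a} t Cγ C≡ r =
    step r (recvStep (suc zero) γ refl a t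
      (λ { zero _ → refl ; (suc zero) 1≢1 → contradiction refl 1≢1 }) Cγ C≡)

  sendAll : ∀ {p q p′ C} ts → Path Sends p ts p′ → Reachable P (⟨ p , q ⟩ , C) →
            Reachable P (⟨ p′ , q ⟩ , λ ξ → C ξ ++ content ts ξ)
  sendAll {C = C} [] refl r = reachable-resp P (λ _ → refl) (λ ξ → sym (++-identityʳ (C ξ))) r
  sendAll {C = C} (t ∷ ts) (_ , e , es) r =
    reachable-resp P (λ _ → refl)
      (λ ξ → trans (++-assoc (C ξ) _ _) (cong (C ξ ++_) (sym (content-++ [ t ] ts ξ))))
      (sendAll ts es (sendMessage e r))

  receiveAll : ∀ {p q q′} us → Path Receives q us q′ → Reachable P (⟨ p , q ⟩ , content us) →
               Reachable P (⟨ p , q′ ⟩ , C⁰ P)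
  receiveAll []             refl         r = r
  receiveAll ((γ , a) ∷ us) (_ , e , es) r =
    receiveAll us es (receiveMessage e (content-same γ us) (λ _ ξ≢γ → sym (content-other us ξ≢γ)) r)

  composite-η : ∀ (S : CompositeState P) j → ⟨ S zero , S (suc zero) ⟩ j ≡ S j
  composite-η S zero       = refl
  composite-η S (suc zero) = refl

  -- A send is never blocked, so the sender can perform its whole trace first and the receiver
  -- consume everything afterwards.
  traces⇒stable : ∀ {S} ts us → Traces (S zero) (S (suc zero)) ts us →
                  (∀ ξ → content ts ξ ≡ content us ξ) → Stable P S
  traces⇒stable {S} ts us (send* , recv*) eq =
    reachable-resp P (composite-η S) (λ _ → refl)
      (receiveAll us recv* (reachable-resp P (λ _ → refl) eq (sendAll ts send*
        (start (λ { zero → refl ; (suc zero) → refl }) λ _ → refl))))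

  -- Closed families and alternating schedules

  Family : Set₁
  Family = (γ : Edge) → Sender → Receiver → Pred (List (M γ)) 0ℓ

  -- U γ p q is to contain the contents of channel γ that occur in states p, q
  -- while the other channel is empty.
  record Closed (U : Family) : Set where
    field
      init   : ∀ γ → U γ (initial zero) (initial (suc zero)) []
      switch : ∀ γ δ p q → U γ p q [] → U δ p q []
      push   : ∀ γ p q a p′ → Sends p (γ , a) p′ → ∀ w → U γ p q w → U γ p′ q (w ∷ʳ a)
      pop    : ∀ γ p q a q′ → Receives q (γ , a) q′ → ∀ w → U γ p q (a ∷ w) → U γ p q′ w
      -- A send over the empty channel `δ` and its receipt count as one move, so the moment at which
      -- both channels may be nonempty is never recorded.
      relay  : ∀ γ δ p q a p′ q′ → δ ≢ γ → Sends p (δ , a) p′ → Receives q (δ , a) q′ →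
               ∀ w → U γ p q w → U γ p′ q′ w

  closed-resp : ∀ {U V} → (∀ γ p q → U γ p q ≐ V γ p q) → Closed U → Closed V
  closed-resp {U} {V} U≐V cl = record
    { init   = λ γ → to (init γ)
    ; switch = λ γ δ p q → to ∘ switch γ δ p q ∘ from
    ; push   = λ γ p q a p′ t w → to ∘ push γ p q a p′ t w ∘ from
    ; pop    = λ γ p q a q′ t w → to ∘ pop γ p q a q′ t w ∘ from
    ; relay  = λ γ δ p q a p′ q′ δ≢γ s t w → to ∘ relay γ δ p q a p′ q′ δ≢γ s t w ∘ from
    }
    where
    open Closed cl
    to : ∀ {γ p q w} → U γ p q w → V γ p q w
    to = proj₁ (U≐V _ _ _)
    from : ∀ {γ p q w} → V γ p q w → U γ p q w
    from = proj₂ (U≐V _ _ _)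

  module _ {U : Family} (cl : Closed U) where
    open Closed cl

    -- The receiver moves whenever it can; the sender moves only while the
    -- receiver waits for a message on an empty channel δ.  As soon as such a
    -- message is sent it is received, so one channel is empty at all times.
    mutual
      run : ∀ us ts {γ p q w p′ q′} → U γ p q w →
            Path Sends p ts p′ → Path Receives q us q′ →
            w ++ content ts γ ≡ content us γ → (∀ ξ → ξ ≢ γ → content ts ξ ≡ content us ξ) →
            ∃ λ δ → U δ p′ q′ []
      -- Nothing is left to receive, so `w` is empty and nothing is left to send.
      run [] ts {γ} {w = w} u sends refl eq eqs
        with refl ← ++-conicalˡ w _ eq
        with refl ← content-empty ts (empty-content γ (++-conicalʳ w _ eq) eqs)
        with refl ← sends = γ , u
      run ((δ , b) ∷ us) ts {γ} {w = w} u sends (_ , t , recvs) eq eqs with δ ≟ γ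
      ... | no δ≢γ =
        await us ts δ≢γ u sends t recvs
          (trans eq (content-other us (δ≢γ ∘ sym)))
          (trans (eqs δ δ≢γ) (content-same δ us))
      -- The receiver waits on `γ` while both channels are empty. After `switch`, `γ` is the awaited
      -- channel and `other γ` the one that may fill up.
      run ((γ , b) ∷ us) ts {w = []} u sends (_ , t , recvs) eq eqs | yes refl =
        await us ts (γ≢other γ) (switch γ (other γ) _ _ u) sends t recvs
          (trans (eqs (other γ) (γ≢other γ ∘ sym)) (content-other us (γ≢other γ ∘ sym)))
          (trans eq (content-same γ us))
      run ((γ , b) ∷ us) ts {w = a ∷ w} u sends (_ , t , recvs) eq eqs | yes refl
        with ∷-injective (trans eq (content-same γ us))
      ... | refl , eq′ =
        run us ts (pop γ _ _ _ _ t _ u) sends recvs eq′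
          (λ ξ ξ≢γ → trans (eqs ξ ξ≢γ) (content-other us ξ≢γ))

      -- The receiver is blocked on `δ`, so messages over `γ` are pushed. The last equation
      -- guarantees that a message over `δ` is still to come and that the first such is `b`; it is
      -- relayed at once.
      await : ∀ us ts {γ δ b p q q″ w p′ q′} → δ ≢ γ → U γ p q w →
              Path Sends p ts p′ → Receives q (δ , b) q″ → Path Receives q″ us q′ →
              w ++ content ts γ ≡ content us γ → content ts δ ≡ b ∷ content us δ →
              ∃ λ δ → U δ p′ q′ []
      await us [] δ≢γ u sends t recvs eq ()
      await us ((ξ , a) ∷ ts) {γ} {δ} {w = w} δ≢γ u (_ , s , sends) t recvs eq eqδ with ξ ≟ γ
      ... | yes refl =
        await us ts δ≢γ (push γ _ _ _ _ s _ u) sends t recvs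
          (trans (++-assoc w _ _) (trans (cong (w ++_) (sym (content-same γ ts))) eq))
          (trans (sym (content-other ts δ≢γ)) eqδ)
      -- With only two channels, a message not sent over `γ` goes over the awaited one.
      ... | no ξ≢γ with refl ← twoEdges δ≢γ ξ≢γ
                   with refl , eqδ′ ← ∷-injective (trans (sym (content-same δ ts)) eqδ) =
        run us ts (relay γ δ _ _ _ _ _ δ≢γ s t _ u) sends recvs
          (trans (cong (w ++_) (sym (content-other ts (δ≢γ ∘ sym)))) eq)
          (λ ζ ζ≢γ → subst (λ ζ → content ts ζ ≡ content us ζ) (sym (twoEdges δ≢γ ζ≢γ)) eqδ′)

    closed-contains-stable : ∀ {S} γ → Stable P S → U γ (S zero) (S (suc zero)) []
    closed-contains-stable γ stable with reachable⇒traces stable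
    ... | ts , us , (send* , recv*) , eq
      with eq₀ ← (λ ξ → trans (eq ξ) (++-identityʳ (content us ξ)))
      with run us ts (init γ) send* recv* (eq₀ γ) (λ ξ _ → eq₀ ξ)
    ... | δ , u = switch δ γ _ _ u

  -- The family of slices of reachable contents

  exact : Family
  exact γ p q = Slice P γ (𝐋 P ⟨ p , q ⟩)

  -- `push` and `pop` are single protocol steps, `relay` is a send followed by its receipt, and
  -- `switch` holds because an empty word on `γ` leaves all channels empty.
  exact-closed : Closed exact
  exact-closed = record
    { init   = λ γ → C⁰ P , start (λ { zero → refl ; (suc zero) → refl }) (λ _ → refl) , refl , λ _ _ → refl
    ; switch = λ { γ δ p q (C , r , Cγ , C≡) →
        C , r , empty-content γ Cγ C≡ δ , λ ξ _ → empty-content γ Cγ C≡ ξ }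
    ; push   = λ { γ p q a p′ t w (C , r , Cγ , C≡) →
        _ , sendMessage t r , cong₂ _++_ Cγ (content-same γ []) ,
        λ ξ ξ≢γ → cong₂ _++_ (C≡ ξ ξ≢γ) (content-other [] ξ≢γ) }
    ; pop    = λ { γ p q a q′ t w (C , r , Cγ , C≡) →
        -- The contents with `w` on `γ` and nothing elsewhere, obtained by projecting a message
        -- sequence.
        content (map (γ ,_) w) ,
        receiveMessage t (trans Cγ (cong (a ∷_) (sym (content-map γ w))))
          (λ ξ ξ≢γ → trans (content-map-other w ξ≢γ) (sym (C≡ ξ ξ≢γ))) r ,
        content-map γ w , λ ξ → content-map-other w }
    ; relay  = λ { γ δ p q a p′ q′ δ≢γ s t w (C , r , Cγ , C≡) →
        C ,
        receiveMessage t
          (trans (cong₂ _++_ (C≡ δ δ≢γ) (content-same δ [])) (cong (a ∷_) (sym (C≡ δ δ≢γ))))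
          (λ ξ ξ≢δ → sym (trans (cong (C ξ ++_) (content-other [] ξ≢δ)) (++-identityʳ (C ξ))))
          (sendMessage s r) ,
        Cγ , C≡ }
    }
    where
    content-map : ∀ γ w → content (map (γ ,_) w) γ ≡ w
    content-map γ []      = refl
    content-map γ (a ∷ w) = trans (content-same γ (map (γ ,_) w)) (cong (a ∷_) (content-map γ w))
    content-map-other : ∀ {γ ξ} w → ξ ≢ γ → content (map (γ ,_) w) ξ ≡ []
    content-map-other []      _   = refl
    content-map-other (a ∷ w) ξ≢γ = trans (content-other (map _ w) ξ≢γ) (content-map-other w ξ≢γ)

  -- Certificates and the decision procedure

  Certificate : Set
  Certificate = (γ : Edge) → Sender → Receiver → Regex (messages γ)

  ⟪_⟫ : Certificate → Family
  ⟪ R ⟫ γ p q = ⟦ R γ p q ⟧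

  -- An inclusion of two languages is universality of the language given by their pointwise
  -- implication, which again has finite index. For `push` and `pop` one side is a quotient by the
  -- letter `a`, on the right and on the left respectively.
  closed? : ∀ R → Dec (Closed ⟪ R ⟫)
  closed? R =
    map′ (λ (i , s , ps , pp , rl) → record { init = i ; switch = s ; push = ps ; pop = pp ; relay = rl })
         (λ cl → let open Closed cl in init , switch , push , pop , relay)
         ( (all? λ γ → member? (fi γ _ _) [])
     ×-dec (all? λ γ → all? λ δ → all? λ p → all? λ q →
              member? (fi γ p q) [] →-dec member? (fi δ p q) [])
     ×-dec (all? λ γ → all? λ p → all? λ q → all? λ a → all? λ p′ →
              transition? _ →-dec
              universal? (⇒-finiteIndex (fi γ p q) (∷ʳ-finiteIndex (fi γ p′ q) a)) any?)
     ×-dec (all? λ γ → all? λ p → all? λ q → all? λ a → all? λ q′ →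
              transition? _ →-dec
              universal? (⇒-finiteIndex (∷-finiteIndex (fi γ p q) a) (fi γ p q′)) any?)
     ×-dec (all? λ γ → all? λ δ → all? λ p → all? λ q → all? λ a → all? λ p′ → all? λ q′ →
              ¬? (δ ≟ γ) →-dec transition? _ →-dec transition? _ →-dec
              universal? (⇒-finiteIndex (fi γ p q) (fi γ p′ q′)) any?))
    where
    fi : ∀ γ p q → FiniteIndex (⟪ R ⟫ γ p q)
    fi γ p q = regex-finiteIndex (R γ p q)

  -- By `switch` all channels agree on the empty word, so testing channel `zero` suffices.
  Excludes : CompositeState P → Certificate → Set
  Excludes S R = Closed ⟪ R ⟫ × ¬ ⟪ R ⟫ zero (S zero) (S (suc zero)) []

  excludes? : ∀ S → Decidable (Excludes S)
  excludes? S R = closed? R ×-dec ¬? (member? (regex-finiteIndex (R zero (S zero) (S (suc zero)))) [])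

  excludes⇒¬stable : ∀ {S} R → Excludes S R → ¬ Stable P S
  excludes⇒¬stable R (cl , ¬u) stable = ¬u (closed-contains-stable cl zero stable)

  certificates : ℕ → List Certificate
  certificates n = tabulations λ _ → tabulations λ _ → tabulations λ _ → regexes n

  -- A run to empty channels is sought as a pair of bounded traces, which spares the search over
  -- interleavings.
  ShortRun : CompositeState P → ℕ → Set
  ShortRun S n = ∃ λ ts → length ts ≤ n × ∃ λ us → length us ≤ n ×
    Traces (S zero) (S (suc zero)) ts us × (∀ ξ → content ts ξ ≡ content us ξ)

  shortRun? : ∀ S n → Dec (ShortRun S n)
  shortRun? S n =
    shortWord? message-searchable n λ ts → shortWord? message-searchable n λ us →
      (path? (λ _ _ _ → transition? _) _ ts _ ×-dec path? (λ _ _ _ → transition? _) _ us _)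
      ×-dec all? λ ξ → ≡-dec _≟_ (content ts ξ) (content us ξ)

  decide : CompositeState P → Computation Bool
  decide S n = verdict (shortRun? S n) (anyList? (excludes? S) (certificates n))

  decide-sound : ∀ S n {b} → decide S n ≡ just b → Reflects (Stable P S) b
  decide-sound S n = verdict-sound (shortRun? S n) (anyList? (excludes? S) (certificates n))
    (λ (ts , _ , us , _ , traces , eq) → traces⇒stable ts us traces eq)
    (λ any → let (R , excl) = satisfied any in excludes⇒¬stable R excl)

  decide-halts-if : ∀ S n → ShortRun S n ⊎ Any (Excludes S) (certificates n) →
                    ∃ λ b → decide S n ≡ just b
  decide-halts-if S n = verdict-halts (shortRun? S n) (anyList? (excludes? S) (certificates n))

  stable⇒shortRun : ∀ {S} → Stable P S → ∃ (ShortRun S)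
  stable⇒shortRun stable with reachable⇒traces stable
  ... | ts , us , traces , eq =
    length ts ⊔ length us , ts , m≤m⊔n _ _ , us , m≤n⊔m (length ts) _ , traces ,
    λ ξ → trans (eq ξ) (++-identityʳ (content us ξ))

  -- Termination under the rational channel property

  module _ (rcp : RationalChannelProperty P) where

    regular : ∀ γ p q → ∃ λ r → ⟦ r ⟧ ≐ exact γ p q
    regular γ p q = slice-regular P γ (rcp ⟨ p , q ⟩)

    exact⇔stable : ∀ S → let r = proj₁ (regular zero (S zero) (S (suc zero))) in
                   (⟦ r ⟧ [] → Stable P S) × (Stable P S → ⟦ r ⟧ [])
    exact⇔stable S with regular zero (S zero) (S (suc zero))
    ... | r , r⊆ , ⊆r =
      (λ u → let (C , reach , Cγ , C≡) = r⊆ u in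
        reachable-resp P (composite-η S) (empty-content zero Cγ C≡) reach) ,
      λ stable → ⊆r (C⁰ P , reachable-resp P (λ j → sym (composite-η S j)) (λ _ → refl) stable ,
                     refl , λ _ _ → refl)

    -- Uses the expressions extracted from `rcp`, and so serves the termination proof alone: it
    -- tells constructively which of the two searches succeeds.
    stable-dec : ∀ S → Dec (Stable P S)
    stable-dec S = map′ (proj₁ (exact⇔stable S)) (proj₂ (exact⇔stable S))
      (member? (regex-finiteIndex (proj₁ (regular zero (S zero) (S (suc zero))))) [])

    -- Each slice has an expression of some depth, and there are finitely many slices. One use of
    -- `eventually-all` for each of `γ`, `p` and `q` yields a common bound.
    exactCertificate : Eventually λ n → Any (λ R → ∀ γ p q → ⟪ R ⟫ γ p q ≐ exact γ p q) (certificates n)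
    exactCertificate =
      eventually-map (tabulations⁺ {R = λ γ f → ∀ p q → ⟦ f p q ⟧ ≐ exact γ p q}) (eventually-all λ γ →
      eventually-map (tabulations⁺ {R = λ p f → ∀ q → ⟦ f q ⟧ ≐ exact γ p q}) (eventually-all λ p →
      eventually-map (tabulations⁺ {R = λ q r → ⟦ r ⟧ ≐ exact γ p q}) (eventually-all λ q →
        let (r , r≐) = regular γ p q in
        depth r , λ n r≤n → Any-map (λ { refl → r≐ }) (∈-regexes r r≤n))))

    -- A certificate denoting the exact family is closed, and the empty word at `S` in it would make
    -- `S` stable.
    ¬stable⇒certificate : ∀ {S} → ¬ Stable P S → ∃ λ n → Any (Excludes S) (certificates n)
    ¬stable⇒certificate {S} ¬stable =
      map₂ (λ {n} ev → Any-map (λ {R} → excludes R) (ev n ≤-refl)) exactCertificate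
      where
      excludes : ∀ R → (∀ γ p q → ⟪ R ⟫ γ p q ≐ exact γ p q) → Excludes S R
      excludes R R≐ =
        closed-resp (λ γ p q → proj₂ (R≐ γ p q) , proj₁ (R≐ γ p q)) exact-closed ,
        λ u → ¬stable (proj₁ (exact⇔stable S) (proj₂ (proj₂ (regular zero p q)) (proj₁ (R≐ zero p q) u)))
        where
        p = S zero
        q = S (suc zero)

    decide-halts : ∀ S → ∃₂ λ n b → decide S n ≡ just b
    decide-halts S = halts-by (stable-dec S)
      where
      halts-by : Dec (Stable P S) → ∃₂ λ n b → decide S n ≡ just b
      halts-by (yes stable) =
        map₂ (λ {n} run → decide-halts-if S n (inj₁ run)) (stable⇒shortRun {S} stable)
      halts-by (no ¬stable) =
        map₂ (λ {n} any → decide-halts-if S n (inj₂ any)) (¬stable⇒certificate {S} ¬stable)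

theorem10p3 : Σ (Algorithm parallelGraph) λ stable? →
    (P : Protocol parallelGraph) → RationalChannelProperty P →
    (S : CompositeState P) →
    ∃ λ (answer : Bool) → (stable? P S ⇓ answer) × Reflects (Stable P S) answer
theorem10p3 = Parallel.decide , correct
  where
  correct : ∀ P → RationalChannelProperty P → ∀ S →
            ∃ λ answer → (Parallel.decide P S ⇓ answer) × Reflects (Stable P S) answer
  correct P rcp S =
    let open Parallel P
        (n , _ , eq) = decide-halts rcp S
        -- The output is read at the first halting time `m`, so soundness is applied at `m` and not
        -- at `n`.
        (answer , m , eqₘ , first) = halts (decide S) n eq
    in answer , (m , eqₘ , first) , decide-sound S m eqₘ
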